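{- Let $G$ be a graph and let $t$ be a fixed positive integer. Then $\operatorname{th}_+(G) \leq t$ if and only if there exist integers $a, k > 0$ and $b \geq 0$ such that $a + b = t$ and $G$ can be obtained from the Cartesian product $K_a \square T_{k,b}$ by contracting tree edges and/or deleting complete edges.
   Context: All graphs are finite, simple and undirected (multiple edges created by a contraction are replaced by a single edge). PSD zero forcing: vertices are blue or white. If $B$ is the current set of blue vertices of $G$ and $W_1,\dots,W_m$ are the vertex sets of the connected components of $G-B$, a blue vertex $u$ can force a white vertex $w$ to become blue (written $u\to w$) if, for some $i$, $w$ is the only white neighbor of $u$ in $G[B\cup W_i]$. For $B\subseteq V(G)$ initially blue (all other vertices white), a chronological list of PSD forces of $B$ is an ordered list of valid forces performed consecutively until no further force is possible; the set of forces in such a list is called a set of PSD forces of $B$. For a set $\mathcal F$ of PSD forces of $B$, let $\mathcal F^{(0)}=B$ and let $\mathcal F^{(s+1)}$ be the set of white vertices $w$ such that some $(u\to w)\in\mathcal F$ is a valid PSD force when exactly $\bigcup_{i=0}^{s}\mathcal F^{(i)}$ is blue. Let $\operatorname{pt}_+(G;\mathcal F)$ be the least $s$ with $\bigcup_{i=0}^{s}\mathcal F^{(i)}=V(G)$ ($\infty$ if there is none), and $\operatorname{pt}_+(G;B)=\min_{\mathcal F}\operatorname{pt}_+(G;\mathcal F)$ over all sets $\mathcal F$ of PSD forces of $B$. The PSD throttling number is $\operatorname{th}_+(G)=\min_{B\subseteq V(G)}\big(|B|+\operatorname{pt}_+(G;B)\big)$. For integers $k>0$ and $b\ge 0$, $T_{k,b}$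 is the rooted tree of height $b$ in which every vertex of depth less than $b$ has exactly $k$ children. In $K_a\square T_{k,b}$, the tree edges are the edges in the copies of $T_{k,b}$, and the complete edges are the edges in the copies of $K_a$. -}

module Defs where

open import Data.Fin.Base using (Fin)
open import Data.Fin.Subset as Subset using (Subset; ∣_∣)
open import Data.List.Base using (List; []; _∷_)
open import Data.List.Membership.Propositional using () renaming (_∈_ to _∈ˡ_)
open import Data.Nat.Base using (ℕ; zero; suc; _+_; _≤_)
open import Data.Product.Base using (_×_; _,_; ∃-syntax)
open import Data.Sum.Base as Sum using (_⊎_; inj₁; inj₂)
open import Function.Bundles using (_⇔_; _↔_; Inverse)
open import Function.Definitions using (StrictlySurjective)
open import Level using (0ℓ)
open import Relation.Binary.Construct.Closure.ReflexiveTransitive using (Star)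
open import Relation.Binary.Core using (Rel)
open import Relation.Binary.Definitions using (Symmetric; Decidable)
open import Relation.Binary.PropositionalEquality
  using (_≡_; _≢_; refl; sym)
open import Relation.Nullary.Negation using (¬_)
open import Relation.Unary using (Pred; _∈_; _∉_; _∪_; ｛_｝)

------------------------------------------------------------------------
-- Simple graphs

record Graph (V : Set) : Set₁ where
  infix 4 _~_
  field
    _~_      : Rel V 0ℓ
    ~-sym    : Symmetric _~_
    ~-irrefl : ∀ {v} → ¬ (v ~ v)

record FiniteGraph (n : ℕ) : Set₁ where
  field
    graph : Graph (Fin n)
  open Graph graph public
  field
    _~?_ : Decidable _~_

record _≅_ {V W : Set} (G : Graph V) (H : Graph W) : Set where
  private
    module G = Graph G
    module H = Graph H
  field
    bijection : V ↔ W
    preserves : ∀ x y → (x G.~ y) ⇔ (Inverse.to bijection x H.~ Inverse.to bijection y)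

_∪ᴳ_ : ∀ {V} → Graph V → Graph V → Graph V
G ∪ᴳ H = record
  { _~_      = λ x y → (x G.~ y) ⊎ (x H.~ y)
  ; ~-sym    = Sum.map G.~-sym H.~-sym
  ; ~-irrefl = λ { (inj₁ e) → G.~-irrefl e ; (inj₂ e) → H.~-irrefl e }
  }
  where
  module G = Graph G
  module H = Graph H

------------------------------------------------------------------------
-- PSD zero forcing

IsLeast : Pred ℕ 0ℓ → Pred ℕ 0ℓ
IsLeast P m = P m × (∀ k → P k → m ≤ k)

module PSDForcing {n : ℕ} (G : Graph (Fin n)) where
  open Graph G

  V : Set
  V = Fin n

  VertexSet : Set₁
  VertexSet = Pred V 0ℓ

  ⟦_⟧ : Subset n → VertexSet
  ⟦ B ⟧ v = v Subset.∈ B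

  WhiteEdge : VertexSet → Rel V 0ℓ
  WhiteEdge B x y = x ∉ B × y ∉ B × x ~ y

  -- For r ∉ B this is the vertex set of the component of G - B containing r;
  -- every component of G - B arises in this way.
  Component : VertexSet → V → VertexSet
  Component B r v = Star (WhiteEdge B) r v

  -- w is a white neighbour of u in G[B ∪ W], where u ∈ B.
  WhiteNeighbour : (B W : VertexSet) → V → V → Set
  WhiteNeighbour B W u w = w ∈ (B ∪ W) × w ∉ B × u ~ w

  OnlyWhiteNeighbour : (B W : VertexSet) → V → V → Set
  OnlyWhiteNeighbour B W u w =
    WhiteNeighbour B W u w × (∀ x → WhiteNeighbour B W u x → x ≡ w)

  ValidForce : VertexSet → V → V → Set
  ValidForce B u w =
    u ∈ B × ∃[ r ] (r ∉ B × OnlyWhiteNeighbour B (Component B r) u w)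

  -- The pair (u , w) stands for the force u → w.
  Forces : Set
  Forces = List (V × V)

  IsChronologicalList : VertexSet → Forces → Set
  IsChronologicalList B []             = ∀ u w → ¬ ValidForce B u w
  IsChronologicalList B ((u , w) ∷ fs) =
    ValidForce B u w × IsChronologicalList (B ∪ ｛ w ｝) fs

  -- A set of forces is represented by a list of its elements: the notions
  -- below depend on F only through membership.

  -- 𝓕⁽ˢ⁺¹⁾ is the set ForcedBy F (BlueAfter B F s), where BlueAfter B F s is
  -- the union of 𝓕⁽⁰⁾ = B, …, 𝓕⁽ˢ⁾.
  ForcedBy : Forces → VertexSet → VertexSet
  ForcedBy F C w = w ∉ C × ∃[ u ] ((u , w) ∈ˡ F × ValidForce C u w)

  BlueAfter : VertexSet → Forces → ℕ → VertexSet
  BlueAfter B F zero    = B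
  BlueAfter B F (suc s) = BlueAfter B F s ∪ ForcedBy F (BlueAfter B F s)

  -- The three minima are given as relations "the value is the natural number
  -- s"; an infinite propagation time is one with no such s, and so never
  -- competes in the minima that follow.

  pt₊-forces : VertexSet → Forces → Pred ℕ 0ℓ
  pt₊-forces B F = IsLeast (λ s → ∀ v → v ∈ BlueAfter B F s)

  pt₊ : VertexSet → Pred ℕ 0ℓ
  pt₊ B = IsLeast (λ s → ∃[ F ] (IsChronologicalList B F × pt₊-forces B F s))

  th₊ : Pred ℕ 0ℓ
  th₊ = IsLeast (λ m → ∃[ B ] ∃[ s ] (pt₊ ⟦ B ⟧ s × m ≡ ∣ B ∣ + s))

ThrottlingNumber : ∀ {n} → FiniteGraph n → Pred ℕ 0ℓ
ThrottlingNumber G = PSDForcing.th₊ (FiniteGraph.graph G)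

------------------------------------------------------------------------
-- Graphs whose edges are divided into tree edges and complete edges

record MarkedGraph : Set₁ where
  constructor marked
  field
    {Vertex} : Set
    tree     : Graph Vertex
    complete : Graph Vertex

  underlying : Graph Vertex
  underlying = tree ∪ᴳ complete

K : (a : ℕ) → Graph (Fin a)
K a = record
  { _~_      = _≢_
  ; ~-sym    = λ x≢y y≡x → x≢y (sym y≡x)
  ; ~-irrefl = λ v≢v → v≢v refl
  }

-- The vertices of T_{k,b}: the root and, when b > 0, the vertices of the k
-- copies of T_{k,b-1} hanging from it.
data TreeVertex (k : ℕ) : ℕ → Set where
  root  : ∀ {b} → TreeVertex k b
  below : ∀ {b} → Fin k → TreeVertex k b → TreeVertex k (suc b)

data IsParent {k : ℕ} : ∀ {b} → TreeVertex k b → TreeVertex k b → Set where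
  top  : ∀ {b} (i : Fin k) → IsParent {b = suc b} root (below i root)
  down : ∀ {b} (i : Fin k) {x y : TreeVertex k b} →
         IsParent x y → IsParent (below i x) (below i y)

T : (k b : ℕ) → Graph (TreeVertex k b)
T k b = record
  { _~_      = λ x y → IsParent x y ⊎ IsParent y x
  ; ~-sym    = Sum.swap
  ; ~-irrefl = λ { (inj₁ p) → irr p ; (inj₂ p) → irr p }
  }
  where
  irr : ∀ {b} {v : TreeVertex k b} → ¬ IsParent v v
  irr (down i p) = irr p

copiesˡ : ∀ {V} (G : Graph V) (W : Set) → Graph (V × W)
copiesˡ G W = record
  { _~_      = λ { (u , x) (v , y) → (u G.~ v) × x ≡ y }
  ; ~-sym    = λ { (e , x≡y) → G.~-sym e , sym x≡y }
  ; ~-irrefl = λ { (e , _) → G.~-irrefl e }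
  }
  where module G = Graph G

copiesʳ : ∀ (V : Set) {W} (H : Graph W) → Graph (V × W)
copiesʳ V H = record
  { _~_      = λ { (u , x) (v , y) → u ≡ v × (x H.~ y) }
  ; ~-sym    = λ { (u≡v , e) → sym u≡v , H.~-sym e }
  ; ~-irrefl = λ { (_ , e) → H.~-irrefl e }
  }
  where module H = Graph H

-- The underlying graph is the Cartesian product of K a and T k b.
K□T : (a k b : ℕ) → MarkedGraph
K□T a k b = marked (copiesʳ (Fin a) (T k b)) (copiesˡ (K a) (TreeVertex k b))

------------------------------------------------------------------------
-- Deleting complete edges and contracting tree edges

-- {x, y} and {u, v} are the same unordered pair.
SamePair : {V : Set} → V → V → V → V → Set
SamePair u v x y = (x ≡ u × y ≡ v) ⊎ (x ≡ v × y ≡ u)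

deleteEdge : ∀ {V} → Graph V → V → V → Graph V
deleteEdge G u v = record
  { _~_      = λ x y → (x G.~ y) × ¬ SamePair u v x y
  ; ~-sym    = λ { (e , ≢uv) → G.~-sym e , λ
                     { (inj₁ (p , q)) → ≢uv (inj₂ (q , p))
                     ; (inj₂ (p , q)) → ≢uv (inj₁ (q , p)) } }
  ; ~-irrefl = λ { (e , _) → G.~-irrefl e }
  }
  where module G = Graph G

-- H is the image of G under the map f, without loops and multiple edges.
IsSimpleImage : ∀ {V W} → (V → W) → Graph V → Graph W → Set
IsSimpleImage f G H =
  ∀ p q → (p H.~ q) ⇔ (p ≢ q × ∃[ x ] ∃[ y ] (f x ≡ p × f y ≡ q × (x G.~ y)))
  where
  module G = Graph G
  module H = Graph H

-- M′ is, up to isomorphism, the result of contracting uv in M; f sends each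
-- vertex of M to the vertex of M′ that it becomes. In graphs obtained from
-- K□T a k b a tree edge never becomes parallel to a complete edge, as the
-- former joins vertices from the same copy of the tree and the latter
-- vertices from different copies.
record IsContraction (M : MarkedGraph) (u v : MarkedGraph.Vertex M)
                     (M′ : MarkedGraph) : Set where
  private
    module M  = MarkedGraph M
    module M′ = MarkedGraph M′
  field
    f          : M.Vertex → M′.Vertex
    surjective : StrictlySurjective _≡_ f
    identifies : ∀ x y → (f x ≡ f y) ⇔ (x ≡ y ⊎ SamePair u v x y)
    tree       : IsSimpleImage f M.tree M′.tree
    complete   : IsSimpleImage f M.complete M′.complete

data _⟶_ : MarkedGraph → MarkedGraph → Set₁ where
  delete-complete : ∀ {V} {S C : Graph V} {u v} →
                    Graph._~_ C u v →
                    marked S C ⟶ marked S (deleteEdge C u v)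
  contract-tree   : ∀ {M M′} {u v} →
                    Graph._~_ (MarkedGraph.tree M) u v →
                    IsContraction M u v M′ →
                    M ⟶ M′

_ObtainableFrom_ : ∀ {n} → FiniteGraph n → MarkedGraph → Set₁
G ObtainableFrom M =
  ∃[ M′ ] (Star _⟶_ M M′ × (MarkedGraph.underlying M′ ≅ FiniteGraph.graph G))

{-# OPTIONS --safe #-}

-- Both sides are compared with maps f from the vertices of K_a □ T_{k,b} onto those of G
-- whose fibres are connected by tree edges, which send tree edges to edges or points, and
-- along which every edge of G lifts; G is obtainable exactly when such a map exists.
--
-- Given f, let the images of the roots be blue. After s rounds the images of all vertices
-- of depth ≤ s are blue, as the fibres of the white vertices in one component lie below
-- a single vertex of depth s + 1.
--
-- Conversely, given a set of a vertices that forces G in b rounds, send (i , p) to the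
-- vertex of the i-th forcing tree that was last to turn blue when the white component
-- has been refined along p, where p lists the components of the white graph containing
-- a given white vertex at times 0, 1, …. Edges lift because a white vertex has at most
-- one blue neighbour in each forcing tree, namely the active one.
module Submission where

open import Defs

open import Data.Fin.Base using (Fin; zero; suc; punchIn; punchOut; fromℕ<)
open import Data.Fin.Properties
  using (_≟_; any?; all?; toℕ<n; suc-injective;
         punchInᵢ≢i; punchOut-cong; punchOut-punchIn; punchOut-injective; +↔⊎; *↔×; 1↔⊤)
open import Data.Fin.Subset as Subset using (Subset; ∣_∣; ⁅_⁆; inside; outside)
open import Data.Fin.Subset.Properties as Subset
  using (_∈?_; anySubset?; x∈⁅x⁆; x∈p∪q⁺; ∣⁅x⁆∣≡1; ∣⊥∣≡0)
open import Data.List.Base as List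
  using (List; []; _∷_; _++_; _∷ʳ_; length; allFin; cartesianProduct; initLast; _∷ʳ′_)
open import Data.List.Membership.Propositional using () renaming (_∈_ to _∈ˡ_)
open import Data.List.Membership.Propositional.Properties
  using (∈-allFin; ∈-map⁺; ∈-cartesianProduct⁺)
open import Data.List.Properties
  using (≡-dec; ∷ʳ-injective; ∷-injectiveˡ; ∷-injectiveʳ; length-++)
open import Data.List.Relation.Unary.Any using (here; there)
open import Data.Nat.Base using (ℕ; zero; suc; pred; _+_; _*_; _∸_; _≤_; _<_; z≤n; s≤s; s≤s⁻¹)
open import Data.Nat.GeneralisedArithmetic using (fold)
open import Data.Nat.Properties as ℕ using ()
open import Data.Product.Base as Prod using (_×_; _,_; proj₁; proj₂; ∃-syntax; Σ-syntax; uncurry)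
open import Data.Product.Function.NonDependent.Propositional using (_×-↔_)
open import Data.Sum.Base as Sum using (_⊎_; inj₁; inj₂; [_,_]; [_,_]′)
open import Data.Sum.Function.Propositional using (_⊎-↔_)
open import Data.Unit.Base using (⊤; tt)
open import Data.Vec.Base as Vec using ([]; _∷_)
open import Function.Base using (_∘_; id; _on_)
open import Function.Bundles using (_⇔_; _↔_; Inverse; Injection; Equivalence; mk⇔; mk↔ₛ′)
open import Function.Construct.Composition using (_↔-∘_)
open import Function.Construct.Identity using (↔-id)
open import Function.Construct.Symmetry using (↔-sym)
open import Function.Properties.Inverse using (↔⇒↣)
open import Function.Definitions using (Injective; StrictlySurjective)
open import Level using (0ℓ)
open import Relation.Binary.Construct.Closure.ReflexiveTransitive as Star
  using (Star; ε; _◅_; _◅◅_)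
open import Relation.Binary.Core using (Rel)
open import Relation.Binary.Definitions as B using (Symmetric)
open import Relation.Binary.PropositionalEquality
  using (_≡_; _≢_; refl; sym; trans; cong; cong₂; subst; subst₂; module ≡-Reasoning)
open import Relation.Nullary.Decidable
  using (Dec; yes; no; map′; ¬?; _×-dec_; _⊎-dec_; _→-dec_; decidable-stable; via-injection)
open import Relation.Nullary.Negation using (¬_; contradiction)
open import Relation.Unary as U using (Pred; _∈_; _∉_; _⊆_; _∪_; ｛_｝)

-- Least numbers, connected components and finite subsets.

least : ∀ {P : Pred ℕ 0ℓ} → U.Decidable P → ∀ m → P m → ∃[ k ] IsLeast P k
least P? m Pm with P? 0
least P? m Pm       | yes P0 = 0 , P0 , λ _ _ → z≤n
least P? zero Pm    | no ¬P0 = contradiction Pm ¬P0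
least P? (suc m) Pm | no ¬P0 with least (P? ∘ suc) m Pm
... | k , Pk , min = suc k , Pk , λ
  { zero P0 → contradiction P0 ¬P0
  ; (suc j) Pj → s≤s (min j Pj)
  }

redirect : ∀ {n} → Fin n → Fin n → Fin n → Fin n
redirect c d z with z ≟ c
... | yes _ = d
... | no _  = z

redirect-source : ∀ {n} (c d : Fin n) → redirect c d c ≡ d
redirect-source c d with c ≟ c
... | yes _  = refl
... | no c≢c = contradiction refl c≢c

redirect-target : ∀ {n} (c d : Fin n) → redirect c d d ≡ d
redirect-target c d with d ≟ c
... | yes _ = refl
... | no _  = refl

module _ {n : ℕ} {E : Rel (Fin n) 0ℓ} (E? : B.Decidable E) (E-sym : Symmetric E) where

  -- The classes of the labels are merged along one edge at a time.
  labelling : ∀ (ps : List (Fin n × Fin n)) → Σ[ ℓ ∈ (Fin n → Fin n) ]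
    (∀ {x y} → (x , y) ∈ˡ ps → E x y → ℓ x ≡ ℓ y)
    × (∀ {x y} → ℓ x ≡ ℓ y → Star E x y)
  labelling [] = id , (λ ()) , λ { refl → ε }
  labelling ((x , y) ∷ ps) with E? x y | labelling ps
  ... | no ¬e | ℓ , joined , connected = ℓ
      , (λ { (here refl) e → contradiction e ¬e ; (there p) e → joined p e })
      , connected
  ... | yes e | ℓ , joined , connected = ℓ′ , joined′ , connected′
    where
    ℓ′ = redirect (ℓ x) (ℓ y) ∘ ℓ

    joined′ : ∀ {p q} → (p , q) ∈ˡ ((x , y) ∷ ps) → E p q → ℓ′ p ≡ ℓ′ q
    joined′ (here refl) _ =
      trans (redirect-source (ℓ x) (ℓ y)) (sym (redirect-target (ℓ x) (ℓ y)))
    joined′ (there p) e′ = cong (redirect (ℓ x) (ℓ y)) (joined p e′)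

    connected′ : ∀ {p q} → ℓ′ p ≡ ℓ′ q → Star E p q
    connected′ {p} {q} eq with ℓ p ≟ ℓ x | ℓ q ≟ ℓ x
    ... | yes p≡x | yes q≡x = connected (trans p≡x (sym q≡x))
    ... | yes p≡x | no _    = connected p≡x ◅◅ e ◅ connected eq
    ... | no _    | yes q≡x = connected eq ◅◅ E-sym e ◅ connected (sym q≡x)
    ... | no _    | no _    = connected eq

  -- Reachability becomes an equality of labels, hence decidable. Labels are vertices, so
  -- `FromForest` can also use them as child indices in a tree.
  component-labelling : Σ[ ℓ ∈ (Fin n → Fin n) ] (∀ {x y} → Star E x y ⇔ (ℓ x ≡ ℓ y))
  component-labelling with labelling (cartesianProduct (allFin n) (allFin n))
  ... | ℓ , joined , connected = ℓ , mk⇔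
    (Star.fold (_≡_ on ℓ)
      (λ e eq → trans (joined (∈-cartesianProduct⁺ (∈-allFin _) (∈-allFin _)) e) eq) refl)
    connected

  star? : B.Decidable (Star E)
  star? x y with component-labelling
  ... | ℓ , connected⇔ = map′ (Equivalence.from connected⇔) (Equivalence.to connected⇔) (ℓ x ≟ ℓ y)

∣p∪q∣≤∣p∣+∣q∣ : ∀ {n} (p q : Subset n) → ∣ p Subset.∪ q ∣ ≤ ∣ p ∣ + ∣ q ∣
∣p∪q∣≤∣p∣+∣q∣ []            []            = z≤n
∣p∪q∣≤∣p∣+∣q∣ (outside ∷ p) (outside ∷ q) = ∣p∪q∣≤∣p∣+∣q∣ p q
∣p∪q∣≤∣p∣+∣q∣ (outside ∷ p) (inside  ∷ q) =
  ℕ.≤-trans (s≤s (∣p∪q∣≤∣p∣+∣q∣ p q)) (ℕ.≤-reflexive (sym (ℕ.+-suc ∣ p ∣ ∣ q ∣)))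
∣p∪q∣≤∣p∣+∣q∣ (inside  ∷ p) (outside ∷ q) = s≤s (∣p∪q∣≤∣p∣+∣q∣ p q)
∣p∪q∣≤∣p∣+∣q∣ (inside  ∷ p) (inside  ∷ q) =
  s≤s (ℕ.≤-trans (∣p∪q∣≤∣p∣+∣q∣ p q) (ℕ.+-monoʳ-≤ ∣ p ∣ (ℕ.n≤1+n ∣ q ∣)))

image : ∀ {a n} → (Fin a → Fin n) → Subset n
image {zero}  h = Subset.⊥
image {suc a} h = ⁅ h zero ⁆ Subset.∪ image (h ∘ suc)

∈-image : ∀ {a n} (h : Fin a → Fin n) i → h i Subset.∈ image h
∈-image h zero    = x∈p∪q⁺ (inj₁ (x∈⁅x⁆ (h zero)))
∈-image h (suc i) = x∈p∪q⁺ (inj₂ (∈-image (h ∘ suc) i))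

∣image∣≤ : ∀ {a n} (h : Fin a → Fin n) → ∣ image h ∣ ≤ a
∣image∣≤ {zero} {n} h = ℕ.≤-reflexive (∣⊥∣≡0 n)
∣image∣≤ {suc a} h = ℕ.≤-trans (∣p∪q∣≤∣p∣+∣q∣ ⁅ h zero ⁆ (image (h ∘ suc)))
  (ℕ.+-mono-≤ (ℕ.≤-reflexive (∣⁅x⁆∣≡1 (h zero))) (∣image∣≤ (h ∘ suc)))

record Enumeration {n} (B : Subset n) : Set where
  field
    element   : Fin ∣ B ∣ → Fin n
    injective : Injective _≡_ _≡_ element
    sound     : ∀ i → element i Subset.∈ B
    complete  : ∀ {v} → v Subset.∈ B → ∃[ i ] element i ≡ v

enumerate : ∀ {n} (B : Subset n) → Enumeration B
enumerate [] = record
  { element = λ () ; injective = λ {} ; sound = λ () ; complete = λ () }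
enumerate (outside ∷ B) = record
  { element   = suc ∘ element
  ; injective = injective ∘ suc-injective
  ; sound     = Vec.there ∘ sound
  ; complete  = λ { (Vec.there v∈B) → Prod.map₂ (cong suc) (complete v∈B) }
  }
  where open Enumeration (enumerate B)
enumerate (inside ∷ B) = record
  { element   = λ { zero → zero ; (suc i) → suc (element i) }
  ; injective = λ
      { {zero}  {zero}  _  → refl
      ; {suc i} {suc j} eq → cong suc (injective (suc-injective eq)) }
  ; sound     = λ { zero → Vec.here ; (suc i) → Vec.there (sound i) }
  ; complete  = λ
      { Vec.here        → zero , refl
      ; (Vec.there v∈B) → Prod.map suc (cong suc) (complete v∈B) }
  }
  where open Enumeration (enumerate B)

-- PSD forcing by rounds

module GreedyForcing {n : ℕ} (G : FiniteGraph n) where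
  open FiniteGraph G
  open PSDForcing graph

  -- The white target `w` lies in the component represented by `r`, so whatever is joined to `w` by
  -- white edges competes under the same uniqueness clause.
  force-target-unique : ∀ {C u w x} → ValidForce C u w →
                        x ∉ C → Component C w x → u ~ x → x ≡ w
  force-target-unique (_ , _ , _ , (inj₁ w∈C , w∉C , _) , _) = contradiction w∈C w∉C
  force-target-unique (_ , _ , _ , (inj₂ r⋯w , _) , only) x∉C w⋯x u~x =
    only _ (inj₂ (r⋯w ◅◅ w⋯x) , x∉C , u~x)

  -- More blue vertices only shrink the component of `w`, so no rival can appear. The target becomes
  -- the new representative, since the old one may have turned blue.
  ValidForce-mono : ∀ {C C′ u w} → C ⊆ C′ → w ∉ C′ → ValidForce C u w → ValidForce C′ u w
  ValidForce-mono {C} {C′} {u} {w} C⊆C′ w∉C′ vf@(u∈C , _ , _ , (_ , _ , u~w) , _) =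
    C⊆C′ u∈C , w , w∉C′ , (inj₂ ε , w∉C′ , u~w) , only
    where
    only : ∀ x → WhiteNeighbour C′ (Component C′ w) u x → x ≡ w
    only x (inj₁ x∈C′ , x∉C′ , _)  = contradiction x∈C′ x∉C′
    only x (inj₂ w⋯x , x∉C′ , u~x) = force-target-unique vf (x∉C′ ∘ C⊆C′)
      (Star.map (λ (x∉ , y∉ , e) → x∉ ∘ C⊆C′ , y∉ ∘ C⊆C′ , e) w⋯x) u~x

  module _ {C : VertexSet} (C? : U.Decidable C) where

    whiteEdge? : B.Decidable (WhiteEdge C)
    whiteEdge? x y = ¬? (C? x) ×-dec ¬? (C? y) ×-dec x ~? y

    WhiteEdge-sym : Symmetric (WhiteEdge C)
    WhiteEdge-sym (x∉C , y∉C , e) = y∉C , x∉C , ~-sym e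

    whiteNeighbour? : ∀ r u → U.Decidable (WhiteNeighbour C (Component C r) u)
    whiteNeighbour? r u x =
      (C? x ⊎-dec star? whiteEdge? WhiteEdge-sym r x) ×-dec ¬? (C? x) ×-dec u ~? x

    validForce? : B.Decidable (ValidForce C)
    validForce? u w = C? u ×-dec any? λ r → ¬? (C? r) ×-dec whiteNeighbour? r u w
      ×-dec all? λ x → whiteNeighbour? r u x →-dec x ≟ w

  -- All valid forces happen at once, without a chosen set of forces. No set is faster
  -- (`BlueAfter⊆Greedy`), and a suitable one keeps pace (`Greedy⊆BlueAfter`).
  Greedy : VertexSet → ℕ → VertexSet
  Greedy B zero    = B
  Greedy B (suc s) = λ w → Greedy B s w ⊎ ∃[ u ] ValidForce (Greedy B s) u w

  greedy? : ∀ {B} → U.Decidable B → ∀ s → U.Decidable (Greedy B s)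
  greedy? B? zero    w = B? w
  greedy? B? (suc s) w = greedy? B? s w ⊎-dec any? λ u → validForce? (greedy? B? s) u w

  Greedy-mono : ∀ {B s s′} → s ≤ s′ → Greedy B s ⊆ Greedy B s′
  Greedy-mono {s′ = zero} z≤n p = p
  Greedy-mono {s′ = suc s′} s≤1+s′ p with ℕ.m≤n⇒m<n∨m≡n s≤1+s′
  ... | inj₁ (s≤s s≤s′) = inj₁ (Greedy-mono s≤s′ p)
  ... | inj₂ refl       = p

  Exhausted : VertexSet → ℕ → Set
  Exhausted B s = ∀ v → v ∈ Greedy B s

  exhausted? : ∀ {B} → U.Decidable B → U.Decidable (Exhausted B)
  exhausted? B? s = all? (greedy? B? s)

  module _ {B : VertexSet} (B? : U.Decidable B) where

    BlueAfter⊆Greedy : ∀ F s → BlueAfter B F s ⊆ Greedy B s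
    BlueAfter⊆Greedy F zero    p        = p
    BlueAfter⊆Greedy F (suc s) (inj₁ p) = inj₁ (BlueAfter⊆Greedy F s p)
    BlueAfter⊆Greedy F (suc s) {w} (inj₂ (_ , u , _ , vf)) with greedy? B? s w
    ... | yes p = inj₁ p
    ... | no ¬p = inj₂ (u , ValidForce-mono (BlueAfter⊆Greedy F s) ¬p vf)

    GreedyForce : V → V → Set
    GreedyForce u w = ∃[ j ] ValidForce (Greedy B j) u w

    -- Being chronological says nothing about speed; remembering that each listed force is available
    -- at some greedy round is what bounds the propagation time.
    GreedyCompletion : VertexSet → Set
    GreedyCompletion C = ∃[ F ] (IsChronologicalList C F ×
      (∀ {w} → w ∉ C → ∃[ u ] ((u , w) ∈ˡ F × GreedyForce u w)))

    extend : ∀ {C u w} s → Greedy B s ⊆ C → w ∉ C → ValidForce (Greedy B s) u w →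
             GreedyCompletion (C ∪ ｛ w ｝) → GreedyCompletion C
    extend {C} {u} {w} s D⊆C w∉C vf (F , chron , forced) =
      (u , w) ∷ F , (ValidForce-mono D⊆C w∉C vf , chron) , forced′
      where
      forced′ : ∀ {x} → x ∉ C → ∃[ v ] ((v , x) ∈ˡ ((u , w) ∷ F) × GreedyForce v x)
      forced′ {x} x∉C with w ≟ x
      ... | yes refl = u , here refl , s , vf
      ... | no w≢x with forced [ x∉C , w≢x ]
      ...   | v , v→x , gf = v , there v→x , gf

    -- Serialises one round: the vertices in `ws` are visited in turn, and a force valid for
    -- `Greedy B s` stays valid for the growing set `C`. The list is built from the front, so later
    -- rounds enter as the continuation `finish`.
    perform-round : ∀ s (ws : List V) {C} → U.Decidable C → Greedy B s ⊆ C →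
                    (∀ {w} → w ∈ Greedy B (suc s) → w ∈ C ⊎ w ∈ˡ ws) →
                    (∀ {C′} → U.Decidable C′ → Greedy B (suc s) ⊆ C′ → GreedyCompletion C′) →
                    GreedyCompletion C
    perform-round s [] C? _ remaining finish =
      finish C? λ p → [ id , (λ ()) ] (remaining p)
    perform-round s (w ∷ ws) {C} C? D⊆C remaining finish with C? w | greedy? B? (suc s) w
    ... | yes w∈C | _ = perform-round s ws C? D⊆C remaining′ finish
      where
      remaining′ : ∀ {x} → x ∈ Greedy B (suc s) → x ∈ C ⊎ x ∈ˡ ws
      remaining′ p with remaining p
      ... | inj₁ x∈C         = inj₁ x∈C
      ... | inj₂ (here refl) = inj₁ w∈C
      ... | inj₂ (there q)   = inj₂ q
    ... | no w∉C | no ¬p = perform-round s ws C? D⊆C remaining′ finish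
      where
      remaining′ : ∀ {x} → x ∈ Greedy B (suc s) → x ∈ C ⊎ x ∈ˡ ws
      remaining′ p with remaining p
      ... | inj₁ x∈C         = inj₁ x∈C
      ... | inj₂ (here refl) = contradiction p ¬p
      ... | inj₂ (there q)   = inj₂ q
    ... | no w∉C | yes (inj₁ p) = contradiction (D⊆C p) w∉C
    ... | no w∉C | yes (inj₂ (u , vf)) = extend s D⊆C w∉C vf
      (perform-round s ws (λ x → C? x ⊎-dec w ≟ x) (inj₁ ∘ D⊆C) remaining′ finish)
      where
      remaining′ : ∀ {x} → x ∈ Greedy B (suc s) → x ∈ (C ∪ ｛ w ｝) ⊎ x ∈ˡ ws
      remaining′ p with remaining p
      ... | inj₁ x∈C         = inj₁ (inj₁ x∈C)
      ... | inj₂ (here refl) = inj₁ (inj₂ refl)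
      ... | inj₂ (there q)   = inj₂ q

    complete-rounds : ∀ d s {C} → Exhausted B (d + s) → U.Decidable C → Greedy B s ⊆ C →
                      GreedyCompletion C
    complete-rounds zero s all-blue C? D⊆C =
      -- Everything is blue, so no force has a white target and the list may end.
      [] , (λ { u w (_ , _ , _ , (_ , w∉C , _) , _) → w∉C (D⊆C (all-blue w)) })
         , λ {w} w∉C → contradiction (D⊆C (all-blue w)) w∉C
    complete-rounds (suc d) s all-blue C? D⊆C =
      perform-round s (allFin n) C? D⊆C (λ _ → inj₂ (∈-allFin _))
        (complete-rounds d (suc s) λ v →
          subst (λ m → Greedy B m v) (sym (ℕ.+-suc d s)) (all-blue v))

    -- The listed force for `w` may differ from the one witnessing greedy membership; it suffices
    -- that it became available no later than round `s`.
    Greedy⊆BlueAfter : ∀ {F} → (∀ {w} → w ∉ B → ∃[ u ] ((u , w) ∈ˡ F × GreedyForce u w)) →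
                       ∀ s → Greedy B s ⊆ BlueAfter B F s
    Greedy⊆BlueAfter forced zero p = p
    Greedy⊆BlueAfter {F} forced (suc s) {w} w∈D′ with greedy? B? s w
    ... | yes w∈D = inj₁ (Greedy⊆BlueAfter forced s w∈D)
    ... | no w∉D with forced (w∉D ∘ Greedy-mono {B} {0} {s} z≤n)
    ...   | u , u→w , j , vf@(_ , _ , _ , (_ , w∉Dⱼ , _) , _) =
      inj₂ (w∉BA , u , u→w , ValidForce-mono Dⱼ⊆BA w∉BA vf)
      where
      w∉BA : w ∉ BlueAfter B F s
      w∉BA = w∉D ∘ BlueAfter⊆Greedy F s

      -- `w` is white in `Greedy B j` and blue in `Greedy B (suc s)`.
      j≤s : j ≤ s
      j≤s = s≤s⁻¹ (ℕ.≰⇒> λ s<j → w∉Dⱼ (Greedy-mono s<j w∈D′))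

      Dⱼ⊆BA : Greedy B j ⊆ BlueAfter B F s
      Dⱼ⊆BA = Greedy⊆BlueAfter forced s ∘ Greedy-mono j≤s

    least-exhausted⇒pt₊ : ∀ {s} → IsLeast (Exhausted B) s → pt₊ B s
    least-exhausted⇒pt₊ {s} (all-blue , least-s)
      with complete-rounds s 0
             (λ v → subst (λ m → Greedy B m v) (sym (ℕ.+-identityʳ s)) (all-blue v)) B? id
    ... | F , chron , forced =
      (F , chron , (λ v → Greedy⊆BlueAfter forced s (all-blue v))
                 , λ j all-blue′ → least-s j (BlueAfter⊆Greedy F j ∘ all-blue′))
      , λ { j (F′ , _ , all-blue′ , _) → least-s j (BlueAfter⊆Greedy F′ j ∘ all-blue′) }

    pt₊⇒exhausted : ∀ {s} → pt₊ B s → Exhausted B s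
    pt₊⇒exhausted {s} ((F , _ , all-blue , _) , _) v = BlueAfter⊆Greedy F s (all-blue v)

  -- The first component keeps the truncated subtraction exact. The property is decidable, so
  -- `least` can search for the throttling number.
  ThrottledBy : ℕ → Subset n → Set
  ThrottledBy t B = ∣ B ∣ ≤ t × Exhausted ⟦ B ⟧ (t ∸ ∣ B ∣)

  throttled? : ∀ t → Dec (∃[ B ] ThrottledBy t B)
  throttled? t = anySubset? λ B → (∣ B ∣ ℕ.≤? t) ×-dec exhausted? (_∈? B) (t ∸ ∣ B ∣)

  throttling-bounded⇔ : ∀ t → (∃[ m ] (ThrottlingNumber G m × m ≤ t)) ⇔ (∃[ B ] ThrottledBy t B)
  throttling-bounded⇔ t = mk⇔ to from
    where
    throttled : ∀ B {s m} → Exhausted ⟦ B ⟧ s → ∣ B ∣ + s ≤ m → ThrottledBy m B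
    throttled B {s} {m} all-blue B+s≤m = ℕ.m+n≤o⇒m≤o ∣ B ∣ B+s≤m , λ v →
      Greedy-mono (ℕ.m+n≤o⇒m≤o∸n s (subst (_≤ m) (ℕ.+-comm ∣ B ∣ s) B+s≤m)) (all-blue v)

    to : ∃[ m ] (ThrottlingNumber G m × m ≤ t) → ∃[ B ] ThrottledBy t B
    to (_ , ((B , s , pt , refl) , _) , m≤t) = B , throttled B (pt₊⇒exhausted (_∈? B) pt) m≤t

    from : ∃[ B ] ThrottledBy t B → ∃[ m ] (ThrottlingNumber G m × m ≤ t)
    from throttled-t with least throttled? t throttled-t
    ... | m , (B , B≤m , all-blue) , least-m with least (exhausted? (_∈? B)) (m ∸ ∣ B ∣) all-blue
    ...   | s , all-blue-s , least-s =
      m , ((B , s , least-exhausted⇒pt₊ (_∈? B) (all-blue-s , least-s) , m≡) , lower)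
        , least-m t throttled-t
      where
      -- `B` itself throttles `∣ B ∣ + s`, so minimality of `m` gives one inequality; minimality of
      -- `s` against `m ∸ ∣ B ∣` gives the other.
      m≡ : m ≡ ∣ B ∣ + s
      m≡ = ℕ.≤-antisym (least-m _ (B , throttled B all-blue-s ℕ.≤-refl))
        (ℕ.≤-trans (ℕ.+-monoʳ-≤ ∣ B ∣ (least-s _ all-blue)) (ℕ.≤-reflexive (ℕ.m+[n∸m]≡n B≤m)))

      lower : ∀ j → ∃[ B′ ] ∃[ s′ ] (pt₊ ⟦ B′ ⟧ s′ × j ≡ ∣ B′ ∣ + s′) → m ≤ j
      lower j (B′ , s′ , pt , refl) =
        least-m _ (B′ , throttled B′ (pt₊⇒exhausted (_∈? B′) pt) ℕ.≤-refl)

-- Models of a graph in a marked graph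

module Edges (M : MarkedGraph) where
  open MarkedGraph M public
  open Graph tree public using () renaming (_~_ to _~ᵗ_)
  open Graph complete public using () renaming (_~_ to _~ᶜ_)
  open Graph underlying public using () renaming (_~_ to _~ᵘ_)

↔-injective : ∀ {A B : Set} (i : A ↔ B) → Injective _≡_ _≡_ (Inverse.to i)
↔-injective i = Injection.injective (↔⇒↣ i)

FibreEdge : ∀ {A : Set} (M : MarkedGraph) → (Edges.Vertex M → A) → Rel (Edges.Vertex M) 0ℓ
FibreEdge M f x y = Edges._~ᵗ_ M x y × f x ≡ f y

-- Soundness is demanded of tree edges, which can only be contracted; complete edges with bad images
-- can be deleted.
record IsModel {n} (G : FiniteGraph n) (M : MarkedGraph)
               (f : Edges.Vertex M → Fin n) : Set where
  private
    module G = FiniteGraph G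
    module M = Edges M
  field
    surjective : StrictlySurjective _≡_ f
    connected  : ∀ {x y} → f x ≡ f y → Star (FibreEdge M f) x y
    tree-sound : ∀ {x y} → x M.~ᵗ y → f x ≢ f y → f x G.~ f y
    lift       : ∀ {u v} → u G.~ v → ∃[ x ] ∃[ y ] (f x ≡ u × f y ≡ v × x M.~ᵘ y)

module _ {n : ℕ} {G : FiniteGraph n} where
  private
    module G = FiniteGraph G

  ≅⇒model : ∀ {M} (i : MarkedGraph.underlying M ≅ G.graph) →
            IsModel G M (Inverse.to (_≅_.bijection i))
  ≅⇒model {M} i = record
    { surjective = λ p → from p , strictlyInverseˡ p
    ; connected  = λ {x} eq → subst (Star _ x) (↔-injective bijection eq) ε
    ; tree-sound = λ e _ → Equivalence.to (preserves _ _) (inj₁ e)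
    ; lift       = λ {u} {v} e → from u , from v , strictlyInverseˡ u , strictlyInverseˡ v ,
        Equivalence.from (preserves _ _)
          (subst₂ G._~_ (sym (strictlyInverseˡ u)) (sym (strictlyInverseˡ v)) e)
    }
    where
    open _≅_ i
    open Inverse bijection

  -- A fibre path lifts edge by edge. Consecutive lifts may end at different preimages of one
  -- vertex, but these are then `u` and `v`, and the contracted edge closes the gap.
  contraction-reflects-model : ∀ {M M′ u v g} → Edges._~ᵗ_ M u v →
    (c : IsContraction M u v M′) → IsModel G M′ g → IsModel G M (g ∘ IsContraction.f c)
  contraction-reflects-model {M} {M′} {u} {v} {g} uv c model = record
    { surjective = λ p → let y , gy≡p = surjective p ; x , fx≡y = c.surjective y in
        x , trans (cong g fx≡y) gy≡p
    ; connected  = λ eq → lift-path (connected eq) refl refl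
    ; tree-sound = λ e gf≢ → tree-sound
        (Equivalence.from (c.tree _ _) (gf≢ ∘ cong g , _ , _ , refl , refl , e)) gf≢
    ; lift       = lift′
    }
    where
    open IsModel model
    module c = IsContraction c
    module M = Edges M

    merged : ∀ {x y} → c.f x ≡ c.f y → Star (FibreEdge M (g ∘ c.f)) x y
    merged {x} {y} eq with Equivalence.to (c.identifies x y) eq
    ... | inj₁ refl                 = ε
    ... | inj₂ (inj₁ (refl , refl)) = (uv , cong g eq) ◅ ε
    ... | inj₂ (inj₂ (refl , refl)) = (Graph.~-sym M.tree uv , cong g eq) ◅ ε

    lift-path : ∀ {p q} → Star (FibreEdge M′ g) p q → ∀ {x y} → c.f x ≡ p → c.f y ≡ q →
                Star (FibreEdge M (g ∘ c.f)) x y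
    lift-path ε refl eq = merged (sym eq)
    lift-path {p} ((e , gp≡gp′) ◅ path) refl eq with Equivalence.to (c.tree _ _) e
    ... | _ , x′ , y′ , fx′≡p , refl , e′ =
      merged (sym fx′≡p) ◅◅ (e′ , trans (cong g fx′≡p) gp≡gp′) ◅ lift-path path refl eq

    lift′ : ∀ {p q} → p G.~ q →
            ∃[ x ] ∃[ y ] (g (c.f x) ≡ p × g (c.f y) ≡ q × x M.~ᵘ y)
    lift′ e with lift e
    ... | _ , _ , refl , refl , inj₁ e′
      with _ , x , y , refl , refl , e″ ← Equivalence.to (c.tree _ _) e′ =
        x , y , refl , refl , inj₁ e″
    ... | _ , _ , refl , refl , inj₂ e′
      with _ , x , y , refl , refl , e″ ← Equivalence.to (c.complete _ _) e′ =
        x , y , refl , refl , inj₂ e″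

  -- Steps are undone from the last one: restoring a complete edge leaves all lifts in place, and
  -- undoing a contraction composes maps.
  obtained⇒model : ∀ {M M′} → Star _⟶_ M M′ → MarkedGraph.underlying M′ ≅ G.graph →
                   ∃[ f ] IsModel G M f
  obtained⇒model {M} ε i = Inverse.to (_≅_.bijection i) , ≅⇒model {M} i
  obtained⇒model (delete-complete _ ◅ steps) i with obtained⇒model steps i
  ... | f , model = f , record
    { surjective = surjective
    ; connected  = connected
    ; tree-sound = tree-sound
    ; lift       = λ e → Prod.map₂ (Prod.map₂ (Prod.map₂ (Prod.map₂ (Sum.map₂ proj₁)))) (lift e)
    }
    where open IsModel model
  obtained⇒model (contract-tree uv c ◅ steps) i with obtained⇒model steps i
  ... | g , model = g ∘ IsContraction.f c , contraction-reflects-model uv c model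

  -- Deleting complete edges whose images are not edges.

  CompleteSound : (M : MarkedGraph) → (Edges.Vertex M → Fin n) → Set
  CompleteSound M f = ∀ {x y} → Edges._~ᶜ_ M x y → f x ≢ f y → f x G.~ f y

  -- The second clause preserves lifts of edges of `G`. The inclusion in `C` settles the head pair,
  -- since an edge once deleted does not return.
  delete-pairs : ∀ {W : Set} {S C : Graph W} → B.DecidableEquality W →
    (f : W → Fin n) → B.Decidable (Graph._~_ C) → (ps : List (W × W)) →
    ∃[ C′ ] ( Star _⟶_ (marked S C) (marked S C′)
            × (∀ {x y} → Graph._~_ C x y → f x G.~ f y → Graph._~_ C′ x y)
            × (∀ {x y} → Graph._~_ C′ x y → Graph._~_ C x y)
            × (∀ {x y} → (x , y) ∈ˡ ps → Graph._~_ C′ x y → f x G.~ f y))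
  delete-pairs {C = C} _≟ᵂ_ f C? [] = C , ε , (λ e _ → e) , id , λ ()
  delete-pairs {S = S} {C} _≟ᵂ_ f C? ((u , v) ∷ ps) with C? u v ×-dec ¬? (f u G.~? f v)
  ... | no keep with delete-pairs {S = S} {C} _≟ᵂ_ f C? ps
  ...   | C′ , steps , kept , C′⊆C , good = C′ , steps , kept , C′⊆C , λ
    { (here refl) e → decidable-stable (f u G.~? f v) λ ¬e → keep (C′⊆C e , ¬e)
    ; (there p) e   → good p e
    }
  delete-pairs {W} {S} {C} _≟ᵂ_ f C? ((u , v) ∷ ps) | yes (uv , bad)
    with delete-pairs {S = S} {deleteEdge C u v} _≟ᵂ_ f (λ x y → C? x y ×-dec ¬? (samePair? x y)) ps
    where
    samePair? : ∀ x y → Dec (SamePair u v x y)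
    samePair? x y = (x ≟ᵂ u ×-dec y ≟ᵂ v) ⊎-dec (x ≟ᵂ v ×-dec y ≟ᵂ u)
  ... | C′ , steps , kept , C′⊆C , good = C′ , delete-complete uv ◅ steps , kept′ , proj₁ ∘ C′⊆C , λ
    { (here refl) e → contradiction (inj₁ (refl , refl)) (proj₂ (C′⊆C e))
    ; (there p) e   → good p e
    }
    where
    kept′ : ∀ {x y} → Graph._~_ C x y → f x G.~ f y → Graph._~_ C′ x y
    kept′ e fe = kept (e , λ { (inj₁ (refl , refl)) → bad fe
                             ; (inj₂ (refl , refl)) → bad (G.~-sym fe) }) fe

  delete-bad-edges : ∀ {N} {M : MarkedGraph} {f} → Edges.Vertex M ↔ Fin N →
    B.Decidable (Edges._~ᶜ_ M) → IsModel G M f →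
    (∀ {x y} → Edges._~ᶜ_ M x y → f x ≢ f y) →
    ∃[ C ] ( Star _⟶_ M (marked (MarkedGraph.tree M) C)
           × IsModel G (marked (MarkedGraph.tree M) C) f
           × CompleteSound (marked (MarkedGraph.tree M) C) f)
  delete-bad-edges {N} {M} {f} enum C? model distinct
    with delete-pairs {S = MarkedGraph.tree M} (via-injection (↔⇒↣ enum) _≟_) f C? pairs
    where
    open Inverse enum
    vertices = List.map from (allFin N)
    pairs = cartesianProduct vertices vertices
  ... | C , steps , kept , _ , good = C , steps , record
      { surjective = surjective
      ; connected  = connected
      ; tree-sound = tree-sound
      ; lift       = λ e → keep-lift e (lift e)
      }
    , λ e _ → good (∈-cartesianProduct⁺ (∈-vertices _) (∈-vertices _)) e
    where
    open IsModel model
    open Inverse enum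
    ∈-vertices : ∀ x → x ∈ˡ List.map from (allFin N)
    ∈-vertices x = subst (_∈ˡ _) (strictlyInverseʳ x) (∈-map⁺ from (∈-allFin (to x)))

    keep-lift : ∀ {u v} → u G.~ v →
      ∃[ x ] ∃[ y ] (f x ≡ u × f y ≡ v × Edges._~ᵘ_ M x y) →
      ∃[ x ] ∃[ y ] (f x ≡ u × f y ≡ v × (Edges._~ᵗ_ M x y ⊎ Graph._~_ C x y))
    keep-lift e (x , y , refl , refl , inj₁ t) = x , y , refl , refl , inj₁ t
    keep-lift e (x , y , refl , refl , inj₂ c) = x , y , refl , refl , inj₂ (kept c e)

-- Contracting tree edges inside fibres.

simpleImage : ∀ {V W : Set} → (V → W) → Graph V → Graph W
simpleImage f H = record
  { _~_      = λ p q → p ≢ q × ∃[ x ] ∃[ y ] (f x ≡ p × f y ≡ q × x H.~ y)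
  ; ~-sym    = λ { (p≢q , x , y , fx≡p , fy≡q , e) → p≢q ∘ sym , y , x , fy≡q , fx≡p , H.~-sym e }
  ; ~-irrefl = λ { (p≢p , _) → p≢p refl }
  }
  where module H = Graph H

module ContractEdge {N n : ℕ} {G : FiniteGraph n} {M : MarkedGraph} {f : Edges.Vertex M → Fin n}
  (enum : Edges.Vertex M ↔ Fin (suc N)) (model : IsModel G M f) (sound : CompleteSound {G = G} M f)
  {u v : Edges.Vertex M} (uv : Edges._~ᵗ_ M u v) (fu≡fv : f u ≡ f v) where

  private
    module G = FiniteGraph G
    module M = Edges M
  open Inverse enum
  open IsModel model

  v≢u : to v ≢ to u
  v≢u eq = Graph.~-irrefl M.tree (subst (u M.~ᵗ_) (↔-injective enum eq) uv)

  -- Removing the slot of `v` and sending `v` to the slot of `u` makes the new vertex set `Fin N`,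
  -- ready for induction on `N`.
  contract : M.Vertex → Fin N
  contract x with to v ≟ to x
  ... | yes _  = punchOut v≢u
  ... | no v≢x = punchOut v≢x

  represent : Fin N → M.Vertex
  represent = from ∘ punchIn (to v)

  contract-represent : ∀ p → contract (represent p) ≡ p
  contract-represent p with to v ≟ to (represent p)
  ... | yes eq = contradiction (sym (trans eq (strictlyInverseˡ _))) (punchInᵢ≢i (to v) p)
  ... | no _   = trans (punchOut-cong (to v) (strictlyInverseˡ _)) (punchOut-punchIn (to v))

  identified : ∀ x y → (contract x ≡ contract y) ⇔ (x ≡ y ⊎ SamePair u v x y)
  identified x y = mk⇔ ⇒ ⇐
    where
    ⇒ : contract x ≡ contract y → x ≡ y ⊎ SamePair u v x y
    ⇒ eq with to v ≟ to x | to v ≟ to y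
    ... | yes v≡x | yes v≡y = inj₁ (↔-injective enum (trans (sym v≡x) v≡y))
    ... | yes v≡x | no v≢y  = inj₂ (inj₂
      (↔-injective enum (sym v≡x) , ↔-injective enum (sym (punchOut-injective v≢u v≢y eq))))
    ... | no v≢x  | yes v≡y = inj₂ (inj₁
      (↔-injective enum (punchOut-injective v≢x v≢u eq) , ↔-injective enum (sym v≡y)))
    ... | no v≢x  | no v≢y  = inj₁ (↔-injective enum (punchOut-injective v≢x v≢y eq))

    u≡v : contract u ≡ contract v
    u≡v with to v ≟ to u | to v ≟ to v
    ... | yes v≡u | _      = contradiction v≡u v≢u
    ... | no _    | no v≢v = contradiction refl v≢v
    ... | no _    | yes _  = punchOut-cong (to v) refl

    ⇐ : x ≡ y ⊎ SamePair u v x y → contract x ≡ contract y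
    ⇐ (inj₁ refl)                 = refl
    ⇐ (inj₂ (inj₁ (refl , refl))) = u≡v
    ⇐ (inj₂ (inj₂ (refl , refl))) = sym u≡v

  contracted : MarkedGraph
  contracted = marked (simpleImage contract M.tree) (simpleImage contract M.complete)

  contraction : IsContraction M u v contracted
  contraction = record
    { f          = contract
    ; surjective = λ p → represent p , contract-represent p
    ; identifies = identified
    ; tree       = λ p q → mk⇔ id id
    ; complete   = λ p q → mk⇔ id id
    }

  f′ : Fin N → Fin n
  f′ = f ∘ represent

  -- `represent` undoes `contract` up to exchanging `u` and `v`, whose images agree.
  f′-contract : ∀ x → f′ (contract x) ≡ f x
  f′-contract x with Equivalence.to (identified _ _) (contract-represent (contract x))
  ... | inj₁ eq                 = cong f eq
  ... | inj₂ (inj₁ (eq , refl)) = trans (cong f eq) fu≡fv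
  ... | inj₂ (inj₂ (eq , refl)) = trans (cong f eq) (sym fu≡fv)

  private
    image-sound : ∀ {H : Graph M.Vertex} → (∀ {x y} → Graph._~_ H x y → f x ≢ f y → f x G.~ f y) →
      ∀ {p q} → Graph._~_ (simpleImage contract H) p q → f′ p ≢ f′ q → f′ p G.~ f′ q
    image-sound H-sound (_ , x , y , refl , refl , e) f≢ =
      subst₂ G._~_ (sym (f′-contract x)) (sym (f′-contract y))
        (H-sound e (subst₂ _≢_ (f′-contract x) (f′-contract y) f≢))

  map-path : ∀ {x y} → Star (FibreEdge M f) x y →
             Star (FibreEdge contracted f′) (contract x) (contract y)
  map-path ε = ε
  map-path {x} (_◅_ {j = z} (e , fx≡fz) path) with contract x ≟ contract z
  ... | yes eq = subst (λ p → Star _ p _) (sym eq) (map-path path)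
  ... | no ne  = ((ne , x , z , refl , refl , e)
      , trans (f′-contract x) (trans fx≡fz (sym (f′-contract z)))) ◅ map-path path

  model′ : IsModel G contracted f′
  model′ = record
    { surjective = λ p → let x , fx≡p = surjective p in contract x , trans (f′-contract x) fx≡p
    ; connected  = λ {p} {q} eq → subst₂ (Star _) (contract-represent p) (contract-represent q)
        (map-path (connected eq))
    ; tree-sound = image-sound {M.tree} tree-sound
    ; lift       = lift′
    }
    where
    lift′ : ∀ {p q} → p G.~ q →
      ∃[ x ] ∃[ y ] (f′ x ≡ p × f′ y ≡ q × Edges._~ᵘ_ contracted x y)
    lift′ {p} {q} e with lift e
    ... | x , y , refl , refl , xy = contract x , contract y , f′-contract x , f′-contract y ,
      Sum.map (λ t → ne , x , y , refl , refl , t) (λ c → ne , x , y , refl , refl , c) xy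
      where
      ne : contract x ≢ contract y
      ne eq = G.~-irrefl (subst (f x G.~_)
        (trans (sym (f′-contract y)) (trans (cong f′ (sym eq)) (f′-contract x))) e)

  sound′ : CompleteSound {G = G} contracted f′
  sound′ = image-sound {M.complete} sound

module _ {n : ℕ} {G : FiniteGraph n} where
  private
    module G = FiniteGraph G

  -- Induction on the number of vertices. If `f` is not injective, two distinct vertices share a
  -- fibre; the path joining them has a first edge, and contracting it leaves a model.
  contract-fibres : ∀ N {M : MarkedGraph} {f} → Edges.Vertex M ↔ Fin N → IsModel G M f →
    CompleteSound {G = G} M f → ∃[ M′ ] (Star _⟶_ M M′ × (MarkedGraph.underlying M′ ≅ G.graph))
  contract-fibres N {M} {f} enum model sound
    with any? (λ p → any? (λ q →
      ¬? (p ≟ q) ×-dec f (Inverse.from enum p) ≟ f (Inverse.from enum q)))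
  contract-fibres N {M} {f} enum model sound | no injective = M , ε , record
    { bijection = mk↔ₛ′ f (proj₁ ∘ surjective) (proj₂ ∘ surjective)
        (λ x → f-injective (proj₂ (surjective (f x))))
    ; preserves = λ x y → mk⇔ preserved reflected
    }
    where
    open IsModel model
    open Inverse enum
    module M = Edges M

    f-injective : ∀ {x y} → f x ≡ f y → x ≡ y
    f-injective {x} {y} eq = decidable-stable (via-injection (↔⇒↣ enum) _≟_ x y)
      λ x≢y → injective (to x , to y , x≢y ∘ ↔-injective enum ,
        trans (cong f (strictlyInverseʳ x)) (trans eq (sym (cong f (strictlyInverseʳ y)))))

    images-differ : ∀ {x y} → x M.~ᵘ y → f x ≢ f y
    images-differ {x} e eq =
      Graph.~-irrefl M.underlying (subst (x M.~ᵘ_) (f-injective (sym eq)) e)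

    preserved : ∀ {x y} → x M.~ᵘ y → f x G.~ f y
    preserved e@(inj₁ t) = tree-sound t (images-differ e)
    preserved e@(inj₂ c) = sound c (images-differ e)

    reflected : ∀ {x y} → f x G.~ f y → x M.~ᵘ y
    reflected e with lift e
    ... | _ , _ , x≡ , y≡ , xy = subst₂ M._~ᵘ_ (f-injective x≡) (f-injective y≡) xy
  contract-fibres (suc N) {M} {f} enum model sound | yes (p , q , p≢q , fp≡fq)
    with IsModel.connected model fp≡fq
  ... | path = first-edge (p≢q ∘ ↔-injective (↔-sym enum)) path
    where
    open Inverse enum

    first-edge : ∀ {x y} → x ≢ y → Star (FibreEdge M f) x y →
                 ∃[ M′ ] (Star _⟶_ M M′ × (MarkedGraph.underlying M′ ≅ G.graph))
    first-edge x≢x ε = contradiction refl x≢x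
    first-edge _ ((uv , fu≡fv) ◅ _) =
      Prod.map₂ (Prod.map₁ (contract-tree uv contraction ◅_))
        (contract-fibres N (↔-id (Fin N)) model′ sound′)
      where open ContractEdge enum model sound uv fu≡fv

-- From models to forcing

TreeVertex↔Fin : ∀ k b → ∃[ N ] (TreeVertex k b ↔ Fin N)
TreeVertex↔Fin k zero    = 1 , mk↔ₛ′ (λ _ → zero) (λ _ → root) (λ { zero → refl }) λ { root → refl }
TreeVertex↔Fin k (suc b) with N , enum ← TreeVertex↔Fin k b =
  1 + k * N , (↔-sym +↔⊎ ↔-∘ (↔-sym 1↔⊤ ⊎-↔ (↔-sym *↔× ↔-∘ (↔-id _ ×-↔ enum)))) ↔-∘ split
  where
  split : TreeVertex k (suc b) ↔ (⊤ ⊎ (Fin k × TreeVertex k b))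
  split = mk↔ₛ′
    (λ { root → inj₁ tt ; (below i x) → inj₂ (i , x) })
    [ (λ _ → root) , uncurry below ]
    (λ { (inj₁ _) → refl ; (inj₂ _) → refl })
    (λ { root → refl ; (below i x) → refl })

-- The child indices on the way from the root, the last one first.
address : ∀ {k b} → TreeVertex k b → List (Fin k)
address root        = []
address (below i x) = address x ∷ʳ i

∷ʳ≢[] : ∀ {A : Set} (xs : List A) {x} → xs ∷ʳ x ≢ []
∷ʳ≢[] []      ()
∷ʳ≢[] (_ ∷ _) ()

length-∷ʳ : ∀ {A : Set} (x : A) xs → length (xs ∷ʳ x) ≡ suc (length xs)
length-∷ʳ x xs = trans (length-++ xs) (ℕ.+-comm (length xs) 1)

address-injective : ∀ {k b} → Injective _≡_ _≡_ (address {k} {b})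
address-injective {x = root}      {root}      _  = refl
address-injective {x = root}      {below j y} eq = contradiction (sym eq) (∷ʳ≢[] (address y))
address-injective {x = below i x} {root}      eq = contradiction eq (∷ʳ≢[] (address x))
address-injective {x = below i x} {below j y} eq with ∷ʳ-injective (address x) (address y) eq
... | eq′ , refl = cong (below i) (address-injective eq′)

length-address : ∀ {k b} (x : TreeVertex k b) → length (address x) ≤ b
length-address root = z≤n
length-address {b = suc b} (below i x) =
  subst (_≤ suc b) (sym (length-∷ʳ i (address x))) (s≤s (length-address x))

-- The index of an outer `below` is the last entry of the address, so the list is taken apart from
-- the back.
vertex-at : ∀ {k} b (l : List (Fin k)) → length l ≤ b → ∃[ x ] address {k} {b} x ≡ l
vertex-at b l l≤b with initLast l
vertex-at b .[] l≤b | [] = root , refl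
vertex-at b .(l ∷ʳ i) l≤b | l ∷ʳ′ i with subst (_≤ b) (length-∷ʳ i l) l≤b
vertex-at (suc b) .(l ∷ʳ i) l≤b | l ∷ʳ′ i | s≤s l≤b′ =
  Prod.map (below i) (cong (_∷ʳ i)) (vertex-at b l l≤b′)

-- Reversed addresses turn a step to a child into a cons; `down` only alters the root end of the
-- list.
IsParent⇒address : ∀ {k b} {x y : TreeVertex k b} → IsParent x y →
                   ∃[ r ] address y ≡ r ∷ address x
IsParent⇒address (top i)    = i , refl
IsParent⇒address (down i p) = Prod.map₂ (cong (_∷ʳ i)) (IsParent⇒address p)

address⇒IsParent : ∀ {k b} {y : TreeVertex k b} {r l} → address y ≡ r ∷ l →
                   ∃[ x ] (IsParent x y × address x ≡ l)
address⇒IsParent {y = below i y} eq with address y in address-y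
address⇒IsParent {y = below i y} refl | []
  with refl ← address-injective {x = y} {root} address-y = root , top i , refl
address⇒IsParent {y = below i y} refl | r ∷ l with address⇒IsParent {y = y} address-y
... | x , x→y , refl = below i x , down i x→y , refl

-- Addresses in the subtree hanging from the vertex at l.
Below : ∀ {k} → List (Fin k) → List (Fin k) → Set
Below l l′ = ∃[ m ] l′ ≡ m ++ l

module _ {k b : ℕ} where

  -- A subtree is joined to the rest of the tree by one edge, at its top vertex.
  leave-subtree : ∀ {l} {x y : TreeVertex k b} → Graph._~_ (T k b) x y →
                  ¬ Below l (address x) → Below l (address y) → address y ≡ l
  leave-subtree (inj₁ x→y) x∉ (m , y∈) with IsParent⇒address x→y | m
  ... | r , eq | []     = y∈
  ... | r , eq | r′ ∷ m = contradiction (m , ∷-injectiveʳ (trans (sym eq) y∈)) x∉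
  leave-subtree (inj₂ y→x) x∉ (m , y∈) with IsParent⇒address y→x
  ... | r , eq = contradiction (r ∷ m , trans eq (cong (r ∷_) y∈)) x∉

  -- The only way out leads to the parent of the top, which is too shallow.
  stay-in-subtree : ∀ {l} {x y : TreeVertex k b} → Graph._~_ (T k b) x y →
                    length l ≤ length (address y) → Below l (address x) → Below l (address y)
  stay-in-subtree (inj₁ x→y) _ (m , x∈) with IsParent⇒address x→y
  ... | r , eq = r ∷ m , trans eq (cong (r ∷_) x∈)
  stay-in-subtree (inj₂ y→x) l≤y (m , x∈) with IsParent⇒address y→x | m
  ... | r , eq | []     = contradiction
    (subst (λ l → length l ≤ _) (trans (sym x∈) eq) l≤y) (ℕ.<-irrefl refl)
  ... | r , eq | r′ ∷ m = m , ∷-injectiveʳ (trans (sym eq) x∈)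

-- Forcing down the trees of a model.

module FromModel {n a k b : ℕ} (G : FiniteGraph n) {f : Fin a × TreeVertex k b → Fin n}
  (model : IsModel G (K□T a k b) f) where
  open FiniteGraph G
  open PSDForcing graph
  open GreedyForcing G
  open IsModel model
  private
    module M = Edges (K□T a k b)

  B : Subset n
  B = image λ i → f (i , root)

  depth : TreeVertex k b → ℕ
  depth = length ∘ address

  module _ {s} (reached : ∀ i x → depth x ≤ s → f (i , x) ∈ Greedy ⟦ B ⟧ s)
           (i : Fin a) {p x : TreeVertex k b} (p→x : IsParent p x) (depth-x : depth x ≡ suc s)
           (white : f (i , x) ∉ Greedy ⟦ B ⟧ s) where

    D : VertexSet
    D = Greedy ⟦ B ⟧ s

    -- The copy is ignored: complete edges keep the tree coordinate, so a white component may spread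
    -- over all copies of the subtree.
    InSubtree : M.Vertex → Set
    InSubtree (_ , y) = Below (address x) (address y)

    ¬parent-in-subtree : ¬ Below (address x) (address p)
    ¬parent-in-subtree (m , eq) with IsParent⇒address p→x
    ... | r , eq′ = ℕ.m+1+n≰m (length (address p)) (ℕ.≤-reflexive (begin
        length (address p) + suc (length m) ≡⟨ ℕ.+-suc _ _ ⟩
        suc (length (address p)) + length m ≡⟨ ℕ.+-comm (suc (length (address p))) _ ⟩
        length m + length (r ∷ address p)   ≡⟨ cong (λ l → length m + length l) eq′ ⟨
        length m + length (address x)       ≡⟨ length-++ m ⟨
        length (m ++ address x)             ≡⟨ cong length eq ⟨
        length (address p)                  ∎))
      where open ≡-Reasoning

    parent-blue : f (i , p) ∈ D
    parent-blue with IsParent⇒address p→x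
    ... | r , eq = reached i p
      (ℕ.≤-reflexive (ℕ.suc-injective (trans (cong length (sym eq)) depth-x)))

    white-deep : ∀ {j y} → f (j , y) ∉ D → length (address x) ≤ depth y
    white-deep {j} {y} y∉D = subst (_≤ depth y) (sym depth-x) (ℕ.≰⇒> (y∉D ∘ reached j y))

    edge-stays : ∀ {y z} → y M.~ᵘ z → f z ∉ D → InSubtree y → InSubtree z
    edge-stays (inj₁ (refl , e)) z∉D = stay-in-subtree e (white-deep z∉D)
    edge-stays (inj₂ (_ , refl)) _   = id

    white-fibre-stays : ∀ {y z} → Star (FibreEdge (K□T a k b) f) y z → f y ∉ D →
                        InSubtree y → InSubtree z
    white-fibre-stays ε _ y∈ = y∈
    white-fibre-stays ((e , eq) ◅ path) y∉D y∈ =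
      white-fibre-stays path z∉D (edge-stays (inj₁ e) z∉D y∈)
      where z∉D = y∉D ∘ subst D (sym eq)

    -- A white edge lifts to some edge between the two fibres; `white-fibre-stays` then carries the
    -- property from its endpoint to the whole fibre.
    component-in-subtree : ∀ {v w} → Component D v w → (∀ {y} → f y ≡ v → InSubtree y) →
                           ∀ {y} → f y ≡ w → InSubtree y
    component-in-subtree ε v∈ = v∈
    component-in-subtree ((_ , w∉D , e) ◅ path) v∈ with lift e
    ... | y , z , y≡v , refl , yz = component-in-subtree path λ z′≡w →
      white-fibre-stays (connected (sym z′≡w)) w∉D (edge-stays yz w∉D (v∈ y≡v))

    -- Tree edges stay in copy `i`, and the subtree could only be entered at `(i , x)`, whose image
    -- is white while the fibre is blue.
    parent-fibre : ∀ {y z} → Star (FibreEdge (K□T a k b) f) y z → f y ≡ f (i , p) →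
                   proj₁ y ≡ i × ¬ InSubtree y → proj₁ z ≡ i × ¬ InSubtree z
    parent-fibre ε _ inv = inv
    parent-fibre {_ , y} (_◅_ {j = _ , z} ((refl , e) , eq) path) fy≡u (refl , y∉) =
      parent-fibre path (trans (sym eq) fy≡u) (refl , λ z∈ → white (subst D
        (trans (sym fy≡u) (trans eq
          (cong (λ z → f (i , z)) (address-injective (leave-subtree e y∉ z∈)))))
        parent-blue))

    force : ValidForce D (f (i , p)) (f (i , x))
    force = parent-blue , f (i , x) , white ,
      (inj₂ ε , white , tree-sound (refl , inj₁ p→x) λ eq → white (subst D eq parent-blue)) , only
      where
      only : ∀ w → WhiteNeighbour D (Component D (f (i , x))) (f (i , p)) w → w ≡ f (i , x)
      only w (inj₁ w∈D , w∉D , _) = contradiction w∈D w∉D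
      -- The lifted edge runs from outside the subtree into it. A complete edge cannot do that, and
      -- a tree edge must end at `x`.
      only w (inj₂ x⋯w , w∉D , u~w) with lift u~w
      ... | (j , y) , (j′ , z) , fy≡u , refl , yz
        with parent-fibre (connected (sym fy≡u)) refl (refl , ¬parent-in-subtree)
           | component-in-subtree x⋯w
               (λ fy≡fx → white-fibre-stays (connected (sym fy≡fx)) white ([] , refl)) refl
      ...   | refl , y∉ | z∈ with yz
      ...     | inj₁ (refl , e)  =
        cong (λ z → f (j , z)) (address-injective (leave-subtree e y∉ z∈))
      ...     | inj₂ (_ , refl) = contradiction z∈ y∉

  reached : ∀ s i x → depth x ≤ s → f (i , x) ∈ Greedy ⟦ B ⟧ s
  reached zero i x depth≤0 with address x in address-x
  ... | [] with refl ← address-injective {x = x} {root} address-x = ∈-image (λ i → f (i , root)) i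
  reached (suc s) i x depth≤ with ℕ.m≤n⇒m<n∨m≡n depth≤
  ... | inj₁ (s≤s depth≤s) = inj₁ (reached s i x depth≤s)
  ... | inj₂ depth≡ with address x in address-x | greedy? (_∈? B) s (f (i , x))
  ...   | _     | yes p = inj₁ p
  ...   | r ∷ l | no white with p , p→x , _ ← address⇒IsParent address-x =
    inj₂ (f (i , p) , force (reached s) i p→x (trans (cong length address-x) depth≡) white)

  throttled : ThrottledBy (a + b) B
  throttled = ℕ.≤-trans (∣image∣≤ _) (ℕ.m≤m+n a b) , λ v → Greedy-mono
    -- As `B` has at most `a` elements, the budget leaves at least `b` rounds.
    (ℕ.m+n≤o⇒m≤o∸n b (ℕ.≤-trans (ℕ.+-monoʳ-≤ b (∣image∣≤ λ i → f (i , root)))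
      (ℕ.≤-reflexive (ℕ.+-comm b a))))
    (let (i , x) , fx≡v = surjective v in
      subst (Greedy ⟦ B ⟧ b) fx≡v (reached b i x (length-address x)))

-- From forcing to models

-- `level` is the round in which a vertex turns blue, `forcer` its parent in the forest, and `owner`
-- the tree containing it. At a root, `forcer` need only stay in the tree.
record ForcingForest {n} (G : FiniteGraph n) (a b : ℕ) : Set where
  open FiniteGraph G
  open PSDForcing graph
  field
    level  : V → ℕ
    forcer : V → V
    start  : Fin a → V
    owner  : V → Fin a

  BlueAt : ℕ → VertexSet
  BlueAt s v = level v ≤ s

  field
    level≤b      : ∀ v → level v ≤ b
    level-start  : ∀ i → level (start i) ≡ 0
    owner-start  : ∀ i → owner (start i) ≡ i
    start-owner  : ∀ {v} → level v ≡ 0 → start (owner v) ≡ v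
    owner-forcer : ∀ v → owner (forcer v) ≡ owner v
    forced       : ∀ {v s} → level v ≡ suc s → ValidForce (BlueAt s) (forcer v) v

-- The forcing forest of a blue set.

module FromBlueSet {n : ℕ} (G : FiniteGraph n) (B : Subset n) (b : ℕ)
  (all-blue : GreedyForcing.Exhausted G (PSDForcing.⟦_⟧ (FiniteGraph.graph G) B) b) where
  open FiniteGraph G
  open PSDForcing graph
  open GreedyForcing G
  open Enumeration (enumerate B)

  least-level : ∀ v → ∃[ s ] IsLeast (λ s → v ∈ Greedy ⟦ B ⟧ s) s
  least-level v = least (λ s → greedy? (_∈? B) s v) b (all-blue v)

  level : V → ℕ
  level v = proj₁ (least-level v)

  level-minimal : ∀ {v s} → v ∈ Greedy ⟦ B ⟧ s → level v ≤ s
  level-minimal {v} {s} = proj₂ (proj₂ (least-level v)) s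

  blue-at-level : ∀ v → v ∈ Greedy ⟦ B ⟧ (level v)
  blue-at-level v = proj₁ (proj₂ (least-level v))

  force-at : ∀ {v s} → level v ≡ suc s → ∃[ u ] ValidForce (λ x → level x ≤ s) u v
  force-at {v} {s} eq with subst (λ s → v ∈ Greedy ⟦ B ⟧ s) eq (blue-at-level v)
  ... | inj₁ early    = contradiction (subst (_≤ s) eq (level-minimal early)) (ℕ.<-irrefl refl)
  ... | inj₂ (u , vf) = u , ValidForce-mono level-minimal
    (λ early → ℕ.<-irrefl refl (subst (_≤ s) eq early)) vf

  -- The level comes with its equation so that proofs can split on it. Letting a root force itself
  -- makes `forcer` total and safe to iterate.
  choose-forcer : ∀ v s → level v ≡ s → V
  choose-forcer v zero    _  = v
  choose-forcer v (suc s) eq = proj₁ (force-at {v} eq)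

  forcer : V → V
  forcer v = choose-forcer v (level v) refl

  forced : ∀ v {s} → level v ≡ suc s → ValidForce (λ x → level x ≤ s) (forcer v) v
  forced v = go (level v) refl
    where
    go : ∀ m (eq : level v ≡ m) {s} → m ≡ suc s →
         ValidForce (λ x → level x ≤ s) (choose-forcer v m eq) v
    go (suc s) eq refl = proj₂ (force-at {v} eq)

  forcer-fixed : ∀ v → level v ≡ 0 → forcer v ≡ v
  forcer-fixed v = go (level v) refl
    where
    go : ∀ m (eq : level v ≡ m) → m ≡ 0 → choose-forcer v m eq ≡ v
    go zero _ _ = refl

  level-forcer : ∀ v → level (forcer v) ≤ pred (level v)
  level-forcer v = go (level v) refl
    where
    go : ∀ m → level v ≡ m → level (forcer v) ≤ pred m
    go zero    eq = ℕ.≤-reflexive (trans (cong level (forcer-fixed v eq)) eq)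
    go (suc s) eq = proj₁ (forced v eq)

  level-iterate : ∀ v j → level (fold v forcer j) ≤ level v ∸ j
  level-iterate v zero    = ℕ.≤-refl
  level-iterate v (suc j) = begin
    level (forcer (fold v forcer j)) ≤⟨ level-forcer (fold v forcer j) ⟩
    pred (level (fold v forcer j))   ≤⟨ ℕ.pred-mono-≤ (level-iterate v j) ⟩
    pred (level v ∸ j)               ≡⟨ ℕ.pred[m∸n]≡m∸[1+n] (level v) j ⟩
    level v ∸ suc j                  ∎
    where open ℕ.≤-Reasoning

  -- Levels are at most `b` and fall at every step until they reach zero, so `b` steps end at a
  -- root.
  origin : V → V
  origin v = fold v forcer b

  level-origin : ∀ v → level (origin v) ≡ 0
  level-origin v = ℕ.n≤0⇒n≡0 (ℕ.≤-trans (level-iterate v b)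
    (ℕ.≤-reflexive (ℕ.m≤n⇒m∸n≡0 (level-minimal {v} {b} (all-blue v)))))

  -- Starting from `forcer v` amounts to one extra step at the end, taken from a root, which is
  -- fixed.
  origin-forcer : ∀ v → origin (forcer v) ≡ origin v
  origin-forcer v = trans (commute b) (forcer-fixed (origin v) (level-origin v))
    where
    commute : ∀ j → fold (forcer v) forcer j ≡ forcer (fold v forcer j)
    commute zero    = refl
    commute (suc j) = cong forcer (commute j)

  origin-fixed : ∀ v → level v ≡ 0 → origin v ≡ v
  origin-fixed v eq = go b
    where
    go : ∀ j → fold v forcer j ≡ v
    go zero    = refl
    go (suc j) = trans (cong forcer (go j)) (forcer-fixed v eq)

  blue-origin : ∀ v → origin v Subset.∈ B
  blue-origin v =
    subst (λ s → origin v ∈ Greedy ⟦ B ⟧ s) (level-origin v) (blue-at-level (origin v))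

  owner : V → Fin ∣ B ∣
  owner v = proj₁ (complete (blue-origin v))

  element-owner : ∀ v → element (owner v) ≡ origin v
  element-owner v = proj₂ (complete (blue-origin v))

  level-element : ∀ i → level (element i) ≡ 0
  level-element i = ℕ.n≤0⇒n≡0 (level-minimal {element i} {0} (sound i))

  forest : ForcingForest G ∣ B ∣ b
  forest = record
    { level        = level
    ; forcer       = forcer
    ; start        = element
    ; owner        = owner
    ; level≤b      = λ v → level-minimal {v} {b} (all-blue v)
    ; level-start  = level-element
    ; owner-start  = λ i → injective
        (trans (element-owner (element i)) (origin-fixed (element i) (level-element i)))
    ; start-owner  = λ {v} eq → trans (element-owner v) (origin-fixed v eq)
    ; owner-forcer = λ v → injective
        (trans (element-owner (forcer v)) (trans (origin-forcer v) (sym (element-owner v))))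
    ; forced       = λ {v} → forced v
    }

-- The model given by a forcing forest.

module FromForest {n a b : ℕ} {G : FiniteGraph n} (forest : ForcingForest G a b) where
  open FiniteGraph G
  open PSDForcing graph
  open GreedyForcing G
  open ForcingForest forest

  blueAt? : ∀ s → U.Decidable (BlueAt s)
  blueAt? s v = level v ℕ.≤? s

  private
    labels : ∀ s → Σ[ ℓ ∈ (V → V) ] (∀ {u v} → Component (BlueAt s) u v ⇔ (ℓ u ≡ ℓ v))
    labels s = component-labelling (whiteEdge? (blueAt? s)) (WhiteEdge-sym (blueAt? s))

  label : ℕ → V → V
  label s = proj₁ (labels s)

  label-component : ∀ s {u v} → label s u ≡ label s v → Component (BlueAt s) u v
  label-component s = Equivalence.from (proj₂ (labels s))

  label-adjacent : ∀ {s u v} → s < level u → s < level v → u ~ v → label s u ≡ label s v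
  label-adjacent {s} s<u s<v e =
    Equivalence.to (proj₂ (labels s)) ((ℕ.<⇒≱ s<u , ℕ.<⇒≱ s<v , e) ◅ ε)

  -- An address in `T n b`: the components of `v` at times below `s`, latest first. `v` is white at
  -- all these times exactly when `s ≤ level v`.
  path : ℕ → V → List V
  path zero    v = []
  path (suc s) v = label s v ∷ path s v

  length-path : ∀ s v → length (path s v) ≡ s
  length-path zero    v = refl
  length-path (suc s) v = cong suc (length-path s v)

  path-adjacent : ∀ s {u v} → s ≤ level u → s ≤ level v → u ~ v → path s u ≡ path s v
  path-adjacent zero    _   _   _ = refl
  path-adjacent (suc s) s<u s<v e = cong₂ _∷_ (label-adjacent s<u s<v e)
    (path-adjacent s (ℕ.<⇒≤ s<u) (ℕ.<⇒≤ s<v) e)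

  node : V → List V
  node v = path (level v) v

  level-node : ∀ {v w s} → node w ≡ path s v → level w ≡ s
  level-node {v} {w} {s} eq =
    trans (sym (length-path (level w) w)) (trans (cong length eq) (length-path s v))

  node-at : ∀ {v s} → level v ≡ s → node v ≡ path s v
  node-at {v} = cong (λ s → path s v)

  -- The vertex of the i-th forcing tree that is last to turn blue on the way from
  -- the root to the given node.
  active : Fin a → List V → V
  active i []      = start i
  active i (r ∷ l) with any? (λ w → ≡-dec _≟_ (node w) (r ∷ l) ×-dec owner w ≟ i)
  ... | yes (w , _) = w
  ... | no _        = active i l

  active-view : ∀ i r l →
    (∃[ w ] (node w ≡ r ∷ l × owner w ≡ i × active i (r ∷ l) ≡ w)) ⊎
    ((∀ w → node w ≡ r ∷ l → owner w ≢ i) × active i (r ∷ l) ≡ active i l)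
  active-view i r l with any? (λ w → ≡-dec _≟_ (node w) (r ∷ l) ×-dec owner w ≟ i)
  ... | yes (w , node-w , owner-w) = inj₁ (w , node-w , owner-w , refl)
  ... | no none = inj₂ ((λ w node-w owner-w → none (w , node-w , owner-w)) , refl)

  -- Named so that the next lemmas can take it as a hypothesis: they serve inside its own induction,
  -- at the preceding time.
  ActiveNeighbour : ℕ → Set
  ActiveNeighbour s = ∀ {u v} → level u ≤ s → s < level v → u ~ v → active (owner u) (path s v) ≡ u

  force-edge : ∀ {v s} → level v ≡ suc s → forcer v ~ v
  force-edge eq with _ , _ , _ , (_ , _ , e) , _ ← forced eq = e

  forcer-active : ∀ {v s} → ActiveNeighbour s → level v ≡ suc s →
                  active (owner v) (path s v) ≡ forcer v
  forcer-active {v} {s} neighbour eq = subst (λ i → active i (path s v) ≡ forcer v) (owner-forcer v)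
    (neighbour (proj₁ (forced eq)) (ℕ.≤-reflexive (sym eq)) (force-edge eq))

  -- Equal heads put `v` and `w` in one white component at time `s`, where `forcer w` has a single
  -- white neighbour.
  target-unique : ∀ {v w s} → ActiveNeighbour s → level w ≡ suc s → s < level v →
    path (suc s) v ≡ path (suc s) w → forcer w ~ v → v ≡ w
  target-unique {s = s} neighbour eq s<v same e = force-target-unique (forced eq) (ℕ.<⇒≱ s<v)
    (label-component s (sym (∷-injectiveˡ same))) e

  -- Both forcers are the active vertex of the same tree at the common shorter path, so they
  -- coincide. Hence the search in `active` is unambiguous.
  node-unique : ∀ {v w s} → ActiveNeighbour s → level v ≡ suc s → level w ≡ suc s →
    path (suc s) v ≡ path (suc s) w → owner v ≡ owner w → v ≡ w
  node-unique {v} {w} {s} neighbour v≡ w≡ same same-owner =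
    target-unique neighbour w≡ (ℕ.≤-reflexive (sym v≡)) same
      (subst (_~ v) same-forcer (force-edge v≡))
    where
    same-forcer : forcer v ≡ forcer w
    same-forcer = trans (sym (forcer-active neighbour v≡))
      (trans (cong₂ active same-owner (∷-injectiveʳ same)) (forcer-active neighbour w≡))

  -- w is forced by u, and v is a white neighbour of u in the same component.
  next-in-tree : ∀ {u v w s} → ActiveNeighbour s → active (owner u) (path s v) ≡ u →
    s < level v → u ~ v → level w ≡ suc s → path (suc s) v ≡ path (suc s) w →
    owner w ≡ owner u → v ≡ w
  next-in-tree {u} {v} {w} {s} neighbour u-active s<v e w≡ same owner-w =
    target-unique neighbour w≡ s<v same (subst (_~ v) (sym forcer-w≡u) e)
    where
    forcer-w≡u : forcer w ≡ u
    forcer-w≡u = trans (sym (forcer-active neighbour w≡))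
      (trans (cong₂ active owner-w (sym (∷-injectiveʳ same))) u-active)

  -- Induction on time; the cases are whether the tree of `u` gains a vertex `w` at this node and
  -- whether `u` has level exactly `suc s`.
  active-neighbour : ∀ s → ActiveNeighbour s
  active-neighbour zero    u≤0 _ _ = start-owner (ℕ.n≤0⇒n≡0 u≤0)
  active-neighbour (suc s) {u} {v} u≤ s<v e
    with active-view (owner u) (label s v) (path s v) | ℕ.m≤n⇒m<n∨m≡n u≤
  ... | inj₂ (_ , eq) | inj₁ (s≤s u≤s) = trans eq (active-neighbour s u≤s (ℕ.<⇒≤ s<v) e)
  -- Being adjacent to `v`, the vertex `u` shares its path and would have been found.
  ... | inj₂ (none , _) | inj₂ u≡ = contradiction refl (none u
    (trans (node-at u≡) (path-adjacent (suc s) (ℕ.≤-reflexive (sym u≡)) (ℕ.<⇒≤ s<v) e)))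
  -- Here `u` forced `w` while `v` was a white neighbour in the same component, so `v` is `w`; but
  -- `v` is still white at time `suc s`.
  ... | inj₁ (w , node-w , owner-w , _) | inj₁ (s≤s u≤s) =
    contradiction (trans (cong level v≡w) w≡) (ℕ.>⇒≢ s<v)
    where
    w≡ = level-node {v} node-w
    v≡w = next-in-tree (active-neighbour s) (active-neighbour s u≤s (ℕ.<⇒≤ s<v) e) (ℕ.<⇒≤ s<v) e
      w≡ (trans (sym node-w) (node-at w≡)) owner-w
  ... | inj₁ (w , node-w , owner-w , eq) | inj₂ u≡ = trans eq
    (node-unique (active-neighbour s) w≡ u≡
      (trans (sym (node-at w≡)) (trans node-w
        (sym (path-adjacent (suc s) (ℕ.≤-reflexive (sym u≡)) (ℕ.<⇒≤ s<v) e))))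
      owner-w)
    where w≡ = level-node {v} node-w

  -- Above level zero, the search at `node v` has `v` as a candidate, and `node-unique` excludes any
  -- other.
  active-node : ∀ v → active (owner v) (node v) ≡ v
  active-node v = go (level v) refl
    where
    go : ∀ s → level v ≡ s → active (owner v) (path s v) ≡ v
    go zero    v≡ = start-owner v≡
    go (suc s) v≡ with active-view (owner v) (label s v) (path s v)
    ... | inj₁ (w , node-w , owner-w , eq) = trans eq (node-unique (active-neighbour s)
      w-level v≡ (trans (sym (node-at w-level)) node-w) owner-w)
      where w-level = level-node {v} node-w
    ... | inj₂ (none , _) = contradiction refl (none v (node-at v≡))

  owner-active : ∀ i l → owner (active i l) ≡ i
  owner-active i []      = owner-start i
  owner-active i (r ∷ l) with active-view i r l
  ... | inj₁ (w , _ , owner-w , eq) = trans (cong owner eq) owner-w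
  ... | inj₂ (_ , eq)               = trans (cong owner eq) (owner-active i l)

  -- The active vertex changes only when a new vertex of the tree turns blue, and `forcer-active`
  -- makes the old one its forcer.
  active-edge : ∀ {i r l} → active i l ≢ active i (r ∷ l) → active i l ~ active i (r ∷ l)
  active-edge {i} {r} {l} ne with active-view i r l
  ... | inj₂ (_ , eq) = contradiction (sym eq) ne
  ... | inj₁ (w , node-w , refl , eq) = step (level w) refl
    where
    step : ∀ s → level w ≡ s → active (owner w) l ~ active (owner w) (r ∷ l)
    step zero    w≡ with () ← trans (sym node-w) (node-at w≡)
    step (suc s) w≡ = subst₂ _~_
      (trans (sym (forcer-active (active-neighbour s) w≡))
        (cong (active (owner w)) (sym (∷-injectiveʳ (trans (sym node-w) (node-at w≡))))))
      (sym eq) (force-edge w≡)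

  private
    module M = Edges (K□T a n b)

  f : M.Vertex → V
  f (i , x) = active i (address x)

  place : ∀ v → ∃[ x ] address {n} {b} x ≡ node v
  place v = vertex-at b (node v) (subst (_≤ b) (sym (length-path (level v) v)) (level≤b v))

  f-place : ∀ v → f (owner v , proj₁ (place v)) ≡ v
  f-place v = trans (cong (active (owner v)) (proj₂ (place v))) (active-node v)

  FibrePath : Rel M.Vertex 0ℓ
  FibrePath = Star (FibreEdge (K□T a n b) f)

  start-node : ∀ i → node (start i) ≡ []
  start-node i = node-at (level-start i)

  -- Going up from `x`, the active vertex is constant until the node where it turned blue, which is
  -- its place. So every fibre is connected through that place.
  path-from-place : ∀ i x → FibrePath (owner (f (i , x)) , proj₁ (place (f (i , x)))) (i , x)
  path-from-place i x = go (address x) refl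
    where
    go : ∀ l {x} → address x ≡ l → FibrePath (owner (f (i , x)) , proj₁ (place (f (i , x)))) (i , x)
    go [] {x} eq = subst₂ (λ j y → FibrePath (j , y) (i , x))
      (sym (owner-active i (address x)))
      (address-injective (trans eq (sym (trans (proj₂ (place _))
        (trans (cong (λ l → node (active i l)) eq) (start-node i)))))) ε
    go (r ∷ l) {x} eq with active-view i r l
    ... | inj₁ (w , node-w , _ , eq′) = subst₂ (λ j y → FibrePath (j , y) (i , x))
      (sym (owner-active i (address x)))
      (address-injective (trans eq (sym (trans (proj₂ (place _))
        (trans (cong (λ l → node (active i l)) eq) (trans (cong node eq′) node-w)))))) ε
    ... | inj₂ (_ , eq′) with address⇒IsParent eq
    ...   | p , p→x , address-p = subst (λ v → FibrePath (owner v , proj₁ (place v)) (i , x)) same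
      (go l address-p ◅◅ ((refl , inj₁ p→x) , same) ◅ ε)
      where
      same : f (i , p) ≡ f (i , x)
      same = trans (cong (active i) address-p) (sym (trans (cong (active i) eq) eq′))

  reverse-path : ∀ {x y} → FibrePath x y → FibrePath y x
  reverse-path = Star.reverse λ (e , eq) → Graph.~-sym M.tree e , sym eq

  -- Equal levels give a complete edge at the common node. Otherwise, equal owners give the tree
  -- edge above the place of `v`, and distinct owners a complete edge at that place.
  lift-edge : ∀ {u v} → u ~ v → level u ≤ level v →
              ∃[ x ] ∃[ y ] (f x ≡ u × f y ≡ v × x M.~ᵘ y)
  lift-edge {u} {v} e u≤v with ℕ.m≤n⇒m<n∨m≡n u≤v
  ... | inj₂ u≡v =
    (owner u , proj₁ (place u)) , (owner v , proj₁ (place v)) , f-place u , f-place v ,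
    inj₂ (owners-differ ,
      address-injective (trans (proj₂ (place u)) (trans same (sym (proj₂ (place v))))))
    where
    same : node u ≡ node v
    same = trans (node-at u≡v) (path-adjacent (level v) (ℕ.≤-reflexive (sym u≡v)) ℕ.≤-refl e)
    owners-differ : owner u ≢ owner v
    owners-differ eq = ~-irrefl (subst (_~ v) (trans (sym (active-node u))
      (trans (cong₂ active eq same) (active-node v))) e)
  ... | inj₁ u<v = go (level v) refl u<v
    where
    go : ∀ s → level v ≡ s → level u < s → ∃[ x ] ∃[ y ] (f x ≡ u × f y ≡ v × x M.~ᵘ y)
    go (suc s) v≡ (s≤s u≤s) with owner u ≟ owner v
      | address⇒IsParent {y = proj₁ (place v)} (trans (proj₂ (place v)) (node-at v≡))
    ... | yes same | p , p→x , address-p =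
      (owner u , p) , (owner v , proj₁ (place v)) ,
      trans (cong (active (owner u)) address-p)
        (active-neighbour s u≤s (ℕ.≤-reflexive (sym v≡)) e) ,
      f-place v , inj₁ (same , inj₁ p→x)
    ... | no differ | p , p→x , address-p =
      (owner u , proj₁ (place v)) , (owner v , proj₁ (place v)) ,
      trans (cong (active (owner u)) (trans (proj₂ (place v)) (node-at v≡))) still-active ,
      f-place v , inj₂ (differ , refl)
      where
      u-active : active (owner u) (path s v) ≡ u
      u-active = active-neighbour s u≤s (ℕ.≤-reflexive (sym v≡)) e

      -- If some `w` replaced `u` here, `u` would have forced it with `v` as a rival, so `w` would
      -- be `v`, which has another owner.
      still-active : active (owner u) (path (suc s) v) ≡ u
      still-active with active-view (owner u) (label s v) (path s v)
      ... | inj₂ (_ , eq) = trans eq u-active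
      ... | inj₁ (w , node-w , owner-w , _) =
        contradiction (trans (sym owner-w) (cong owner (sym v≡w))) differ
        where
        w≡ = level-node {v} node-w
        v≡w = next-in-tree (active-neighbour s) u-active (ℕ.≤-reflexive (sym v≡)) e
          w≡ (trans (sym node-w) (node-at w≡)) owner-w

  model : IsModel G (K□T a n b) f
  model = record
    { surjective = λ v → (owner v , proj₁ (place v)) , f-place v
    ; connected  = λ {x} {y} eq → reverse-path (path-from-place (proj₁ x) (proj₂ x)) ◅◅
        subst (λ v → FibrePath (owner v , proj₁ (place v)) y) (sym eq)
          (path-from-place (proj₁ y) (proj₂ y))
    ; tree-sound = tree-sound
    ; lift       = λ {u} {v} e → [ lift-edge e , (λ v≤u → swap (lift-edge (~-sym e) v≤u)) ]′
        (ℕ.≤-total (level u) (level v))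
    }
    where
    tree-sound : ∀ {x y} → x M.~ᵗ y → f x ≢ f y → f x ~ f y
    tree-sound {i , x} {_ , y} (refl , inj₁ x→y) ne with r , eq ← IsParent⇒address x→y
      rewrite eq = active-edge ne
    tree-sound {i , x} {_ , y} (refl , inj₂ y→x) ne with r , eq ← IsParent⇒address y→x
      rewrite eq = ~-sym (active-edge (ne ∘ sym))

    swap : ∀ {u v} → ∃[ x ] ∃[ y ] (f x ≡ u × f y ≡ v × x M.~ᵘ y) →
           ∃[ x ] ∃[ y ] (f x ≡ v × f y ≡ u × x M.~ᵘ y)
    swap (x , y , fx , fy , e) = y , x , fy , fx , Graph.~-sym M.underlying {x} {y} e

  copies-distinct : ∀ {x y} → x M.~ᶜ y → f x ≢ f y
  copies-distinct {i , x} {j , y} (i≢j , _) eq = i≢j (trans (sym (owner-active i (address x)))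
    (trans (cong owner eq) (owner-active j (address y))))

  complete? : B.Decidable M._~ᶜ_
  complete? (i , x) (j , y) =
    ¬? (i ≟ j) ×-dec via-injection (↔⇒↣ (proj₂ (TreeVertex↔Fin n b))) _≟_ x y

  -- Deletions come first, so every complete edge is sound before contractions merge edges.
  obtainable : G ObtainableFrom K□T a n b
  obtainable with N , enum ← TreeVertex↔Fin n b
    with enum′ ← ↔-sym *↔× ↔-∘ (↔-id (Fin a) ×-↔ enum)
    with C , deletions , model′ , sound ←
      delete-bad-edges {G = G} enum′ complete? model copies-distinct
    with M′ , contractions , iso ← contract-fibres {G = G} _ enum′ model′ sound
    = M′ , deletions ◅◅ contractions , iso

theorem2p10 : ∀ {n : ℕ} (G : FiniteGraph n) → 0 < n →
    ∀ (t : ℕ) → 0 < t →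
    (∃[ m ] (ThrottlingNumber G m × m ≤ t))
    ⇔
    (∃[ a ] ∃[ k ] ∃[ b ]
    (0 < a × 0 < k × a + b ≡ t × G ObtainableFrom K□T a k b))
theorem2p10 {n} G 0<n t _ = mk⇔ to from
  where
  open GreedyForcing G

  to : ∃[ m ] (ThrottlingNumber G m × m ≤ t) →
       ∃[ a ] ∃[ k ] ∃[ b ] (0 < a × 0 < k × a + b ≡ t × G ObtainableFrom K□T a k b)
  to bounded with B , B≤t , all-blue ← Equivalence.to (throttling-bounded⇔ t) bounded =
    -- Component labels are vertices, hence `n` children. The blue set is nonempty because a vertex
    -- of `G` has an owner.
    ∣ B ∣ , n , t ∸ ∣ B ∣ , ℕ.≤-trans (s≤s z≤n) (toℕ<n (owner (fromℕ< 0<n))) , 0<n ,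
    ℕ.m+[n∸m]≡n B≤t , FromForest.obtainable forest
    where open FromBlueSet G B (t ∸ ∣ B ∣) all-blue

  from : ∃[ a ] ∃[ k ] ∃[ b ] (0 < a × 0 < k × a + b ≡ t × G ObtainableFrom K□T a k b) →
         ∃[ m ] (ThrottlingNumber G m × m ≤ t)
  from (a , k , b , _ , _ , refl , M′ , steps , iso)
    with _ , model ← obtained⇒model {G = G} steps iso =
    Equivalence.from (throttling-bounded⇔ t) (FromModel.B G model , FromModel.throttled G model)
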